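{- Let $H$ be a locally compact topological group, $K$ a symmetric compact subset of $H$, $\Lambda$ a group, and $f:\Lambda\to(H:K)$ a quasi-homomorphism with $f(xy^{ -1})\in f(x)f(y)^{ -1}K$ for all $x,y\in\Lambda$. Then all sets $X=f^{ -1}(UK)$, with $U$ a compact neighborhood of the identity in $H$, are right-commensurable to each other in $\Lambda$. Thus any symmetric set sandwiched (with respect to inclusion) between two such sets is an approximate subgroup. In particular, for each such $X$, the set $XX^{ -1}$ is an approximate subgroup.
   Context: A subset $S$ of a group is symmetric if $1\in S=S^{ -1}$. Two subsets are (right-)commensurable if each is covered by finitely many right translates of the other. A symmetric subset $S$ is an approximate subgroup if $S$ and $S^2$ are commensurable. A quasi-homomorphism $f:\Lambda\to(H:K)$ is a map $\Lambda\to H$ with $f(1)=1$ and $f(xy^{ -1})\in f(x)f(y^{ -1})K$ for all $x,y$. (The set $K$ is not assumed to be conjugation-invariant.) -}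

module Defs where

open import Level using (Level; _⊔_; suc)
open import Algebra.Bundles using (Group)
open import Data.List.Relation.Unary.Any using (Any)
open import Data.Product.Base using (∃-syntax; _×_; _,_)
open import Data.Product.Relation.Binary.Pointwise.NonDependent using (×-setoid)
open import Data.Unit.Polymorphic.Base using (⊤)
open import Function.Bundles using (Func)
open import Relation.Binary.Bundles using (Setoid)
open import Relation.Binary.Definitions using (_Respects_)
open import Relation.Unary using (Pred)

private
  variable
    ℓ o o₁ o₂ : Level

------------------------------------------------------------------------
-- Subsets of a setoid

record Subset (S : Setoid ℓ ℓ) : Set (suc ℓ) where
  open Setoid S
  field
    mem      : Pred Carrier ℓ
    respects : mem Respects _≈_

open Subset public

infix 4 _∈_ _⊆_ _≐_

_∈_ : {S : Setoid ℓ ℓ} → Setoid.Carrier S → Subset S → Set ℓ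
x ∈ A = mem A x

_⊆_ : {S : Setoid ℓ ℓ} → Subset S → Subset S → Set ℓ
_⊆_ {S = S} A B = ∀ (x : Setoid.Carrier S) → x ∈ A → x ∈ B

_≐_ : {S : Setoid ℓ ℓ} → Subset S → Subset S → Set ℓ
A ≐ B = (A ⊆ B) × (B ⊆ A)

full : {S : Setoid ℓ ℓ} → Subset S
full = record { mem = λ _ → ⊤ ; respects = λ _ t → t }

_∩_ : {S : Setoid ℓ ℓ} → Subset S → Subset S → Subset S
A ∩ B = record
  { mem      = λ x → (x ∈ A) × (x ∈ B)
  ; respects = λ { e (a , b) → respects A e a , respects B e b }
  }

⋃ : {S : Setoid ℓ ℓ} {I : Set ℓ} → (I → Subset S) → Subset S
⋃ A = record
  { mem      = λ x → ∃[ i ] (x ∈ A i)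
  ; respects = λ { e (i , a) → i , respects (A i) e a }
  }

preimage : {S T : Setoid ℓ ℓ} → Func S T → Subset T → Subset S
preimage f B = record
  { mem      = λ x → Func.to f x ∈ B
  ; respects = λ e b → respects B (Func.cong f e) b
  }

------------------------------------------------------------------------
-- Topology

-- Unions are over families indexed by types in the universe of the
-- points.  Under excluded middle at ℓ this is no restriction: up to ≐,
-- subsets are then Boolean functions on the points, so every collection
-- of subsets is the image of a family indexed in Set ℓ.  The same
-- applies to the covers in IsCompact.
record Topology (S : Setoid ℓ ℓ) (o : Level) : Set (suc ℓ ⊔ suc o) where
  field
    Open      : Subset S → Set o
    open-resp : ∀ {A B} → A ≐ B → Open A → Open B
    open-full : Open full
    open-∩    : ∀ {A B} → Open A → Open B → Open (A ∩ B)
    open-⋃    : ∀ {I : Set ℓ} (A : I → Subset S) →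
                (∀ i → Open (A i)) → Open (⋃ A)

open Topology public using (Open)

×-topology : {S T : Setoid ℓ ℓ} → Topology S o₁ → Topology T o₂ →
             Topology (×-setoid S T) (suc ℓ ⊔ o₁ ⊔ o₂)
×-topology {S = S} {T = T} 𝒮 𝒯 = record
  { Open      = λ W → ∀ x y → (x , y) ∈ W →
                ∃[ A ] ∃[ B ] Open 𝒮 A × Open 𝒯 B × x ∈ A × y ∈ B ×
                  (∀ a b → a ∈ A → b ∈ B → (a , b) ∈ W)
  ; open-resp = λ { (W⊆W′ , W′⊆W) oW x y w →
      let (A , B , oA , oB , xA , yB , box) = oW x y (W′⊆W (x , y) w)
      in A , B , oA , oB , xA , yB ,
         λ a b aA bB → W⊆W′ (a , b) (box a b aA bB) }
  ; open-full = λ x y t →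
      full , full , Topology.open-full 𝒮 , Topology.open-full 𝒯 , t , t ,
      λ _ _ _ _ → t
  ; open-∩    = λ { oW oW′ x y (w , w′) →
      let (A , B , oA , oB , xA , yB , box)       = oW x y w
          (A′ , B′ , oA′ , oB′ , xA′ , yB′ , box′) = oW′ x y w′
      in A ∩ A′ , B ∩ B′ ,
         Topology.open-∩ 𝒮 oA oA′ , Topology.open-∩ 𝒯 oB oB′ ,
         (xA , xA′) , (yB , yB′) ,
         λ { a b (aA , aA′) (bB , bB′) → box a b aA bB , box′ a b aA′ bB′ } }
  ; open-⋃    = λ { W oW x y (i , w) →
      let (A , B , oA , oB , xA , yB , box) = oW i x y w
      in A , B , oA , oB , xA , yB ,
         λ a b aA bB → i , box a b aA bB }
  }

Continuous : {S T : Setoid ℓ ℓ} → Topology S o₁ → Topology T o₂ →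
             Func S T → Set (suc ℓ ⊔ o₁ ⊔ o₂)
Continuous 𝒮 𝒯 f = ∀ B → Open 𝒯 B → Open 𝒮 (preimage f B)

IsCompact : {S : Setoid ℓ ℓ} → Topology S o → Subset S → Set (suc ℓ ⊔ o)
IsCompact {ℓ = ℓ} {S = S} 𝒮 K =
  ∀ (I : Set ℓ) (A : I → Subset S) → (∀ i → Open 𝒮 (A i)) → K ⊆ ⋃ A →
  ∃[ is ] (∀ x → x ∈ K → Any (λ i → x ∈ A i) is)

IsNeighbourhood : {S : Setoid ℓ ℓ} → Topology S o →
                  Setoid.Carrier S → Subset S → Set (suc ℓ ⊔ o)
IsNeighbourhood 𝒮 x N = ∃[ A ] Open 𝒮 A × x ∈ A × A ⊆ N

IsLocallyCompact : {S : Setoid ℓ ℓ} → Topology S o → Set (suc ℓ ⊔ o)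
IsLocallyCompact {S = S} 𝒮 =
  ∀ (x : Setoid.Carrier S) → ∃[ N ] IsNeighbourhood 𝒮 x N × IsCompact 𝒮 N

-- No separation axiom is imposed.
record TopologicalGroup (ℓ o : Level) : Set (suc (suc ℓ ⊔ o)) where
  field
    group    : Group ℓ ℓ
  open Group group public
  field
    topology : Topology setoid o

  mulFunc : Func (×-setoid setoid setoid) setoid
  mulFunc = record
    { to = λ { (x , y) → x ∙ y } ; cong = λ { (p , q) → ∙-cong p q } }

  invFunc : Func setoid setoid
  invFunc = record { to = _⁻¹ ; cong = ⁻¹-cong }

  field
    mul-continuous : Continuous (×-topology topology topology) topology mulFunc
    inv-continuous : Continuous topology topology invFunc

------------------------------------------------------------------------
-- Subsets of a group

module _ (G : Group ℓ ℓ) where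
  open Group G

  private
    Sub : Set (suc ℓ)
    Sub = Subset setoid

  setProduct : Sub → Sub → Sub
  setProduct A B = record
    { mem      = λ x → ∃[ a ] ∃[ b ] a ∈ A × b ∈ B × x ≈ a ∙ b
    ; respects = λ { e (a , b , aA , bB , p) →
                     a , b , aA , bB , trans (sym e) p }
    }

  setInverse : Sub → Sub
  setInverse A = record
    { mem      = λ x → ∃[ a ] a ∈ A × x ≈ a ⁻¹
    ; respects = λ { e (a , aA , p) → a , aA , trans (sym e) p }
    }

  leftTranslate : Carrier → Sub → Sub
  leftTranslate g A = record
    { mem      = λ x → ∃[ a ] a ∈ A × x ≈ g ∙ a
    ; respects = λ { e (a , aA , p) → a , aA , trans (sym e) p }
    }

  rightTranslate : Sub → Carrier → Sub
  rightTranslate A g = record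
    { mem      = λ x → ∃[ a ] a ∈ A × x ≈ a ∙ g
    ; respects = λ { e (a , aA , p) → a , aA , trans (sym e) p }
    }

  IsSymmetric : Sub → Set ℓ
  IsSymmetric S = ε ∈ S × S ≐ setInverse S

  CoveredByRightTranslates : Sub → Sub → Set ℓ
  CoveredByRightTranslates A B =
    ∃[ gs ] (∀ x → x ∈ A → Any (λ g → x ∈ rightTranslate B g) gs)

  Commensurable : Sub → Sub → Set ℓ
  Commensurable A B =
    CoveredByRightTranslates A B × CoveredByRightTranslates B A

  IsApproximateSubgroup : Sub → Set ℓ
  IsApproximateSubgroup S = IsSymmetric S × Commensurable S (setProduct S S)

IsQuasiHomomorphism : (Λ H : Group ℓ ℓ) → Subset (Group.setoid H) →
                      Func (Group.setoid Λ) (Group.setoid H) → Set ℓ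
IsQuasiHomomorphism Λ H K f =
  (to Λ.ε H.≈ H.ε) ×
  (∀ x y → to (x Λ.∙ y Λ.⁻¹) ∈ leftTranslate H (to x H.∙ to (y Λ.⁻¹)) K)
  where
  module Λ = Group Λ
  module H = Group H
  open Func f

IsCompactIdentityNeighbourhood :
  (H : TopologicalGroup ℓ o) →
  Subset (TopologicalGroup.setoid H) → Set (suc ℓ ⊔ o)
IsCompactIdentityNeighbourhood H U =
  IsCompact H.topology U × IsNeighbourhood H.topology H.ε U
  where module H = TopologicalGroup H

{-# OPTIONS --safe #-}

-- Compactness enters only through total boundedness: a set A is totally bounded
-- if each open identity neighbourhood W has finitely many right translates
-- covering A.  Totally bounded sets are closed under products.  If C is totally
-- bounded, choose W with W W⁻¹ ⊆ V, cover C by translates W h, and pick, where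
-- possible, a point g ∈ Λ with f(g) ∈ W h.  Any other x with f(x) ∈ W h satisfies
-- f(x g⁻¹) ∈ f(x) f(g)⁻¹ K ⊆ V K, so f⁻¹(C) is covered by the finitely many
-- translates f⁻¹(V K) g.  Commensurability is the case C = U K; for a symmetric S
-- the image of S² lies in f(S) f(S) K, which is totally bounded if f(S) is.
module Submission where

open import Defs
open import Level using (Level; _⊔_; suc)
open import Algebra.Bundles using (Group)
import Algebra.Properties.Group as GroupProperties
open import Axiom.ExcludedMiddle using (ExcludedMiddle)
open import Data.List.Base using ([]; [_]; concatMap)
open import Data.List.Relation.Unary.Any as Any using (Any; here)
open import Data.List.Relation.Unary.Any.Properties using (concatMap⁺)
open import Data.Product.Base using (∃-syntax; _×_; _,_; proj₁; proj₂)
open import Function.Bundles using (Func)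
import Relation.Binary.Reasoning.Setoid as SetoidReasoning
open import Relation.Nullary.Decidable.Core using (yes; no)
open import Relation.Nullary.Negation.Core using (contradiction)

private
  variable
    a i j p q : Level

-- Finite covers compose by concatenating their lists. The index types `I` and `J` may differ, which
-- lets centres in `H` be traded for translating elements of `Λ`.
refineCover : {A : Set a} {I : Set i} {J : Set j}
  {P : I → A → Set p} {Q : J → A → Set q} →
  (∀ i → ∃[ js ] (∀ x → P i x → Any (λ j → Q j x) js)) →
  ∀ is → ∃[ js ] (∀ x → Any (λ i → P i x) is → Any (λ j → Q j x) js)
refineCover cover is =
  concatMap (λ i → proj₁ (cover i)) is ,
  λ x x∈ → concatMap⁺ (λ i → proj₁ (cover i)) (Any.map (λ {i} → proj₂ (cover i) x) x∈)

-- Right translates and symmetric subsets of a group.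

module GroupSubsets {ℓ : Level} (G : Group ℓ ℓ) where
  open Group G
  open GroupProperties G

  private
    Sub : Set (suc ℓ)
    Sub = Subset setoid

  quotient∈⇒∈rightTranslate : ∀ (A : Sub) {x g} →
    x ∙ g ⁻¹ ∈ A → x ∈ rightTranslate G A g
  quotient∈⇒∈rightTranslate A {x} {g} x/g∈A =
    x ∙ g ⁻¹ , x/g∈A , sym (//-rightDividesˡ g x)

  coveredByRightTranslates-mono : ∀ {A B C D : Sub} → A ⊆ B → C ⊆ D →
    CoveredByRightTranslates G B C → CoveredByRightTranslates G A D
  coveredByRightTranslates-mono A⊆B C⊆D (gs , cover) =
    gs , λ x x∈A → Any.map (λ { (c , c∈C , e) → c , C⊆D c c∈C , e })
                           (cover x (A⊆B x x∈A))

  ⊆⇒coveredByRightTranslates : ∀ {A B : Sub} → A ⊆ B →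
    CoveredByRightTranslates G A B
  ⊆⇒coveredByRightTranslates A⊆B =
    [ ε ] , λ x x∈A → here (x , A⊆B x x∈A , sym (identityʳ x))

  ε∈B⇒A⊆AB : ∀ (A B : Sub) → ε ∈ B → A ⊆ setProduct G A B
  ε∈B⇒A⊆AB A B ε∈B x x∈A = x , ε , x∈A , ε∈B , sym (identityʳ x)

  ε∈setInverse : ∀ (A : Sub) → ε ∈ A → ε ∈ setInverse G A
  ε∈setInverse A ε∈A = ε , ε∈A , sym ε⁻¹≈ε

  symmetric-⁻¹ : ∀ (A : Sub) → IsSymmetric G A → ∀ {x} → x ∈ A → x ⁻¹ ∈ A
  symmetric-⁻¹ A (_ , _ , A⁻¹⊆A) {x} x∈A = A⁻¹⊆A (x ⁻¹) (x , x∈A , refl)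

  AA⁻¹-symmetric : ∀ (A : Sub) → ε ∈ A →
    IsSymmetric G (setProduct G A (setInverse G A))
  AA⁻¹-symmetric A ε∈A =
    ε∈B⇒A⊆AB A (setInverse G A) (ε∈setInverse A ε∈A) ε ε∈A ,
    (λ { x (a , c , a∈A , (b , b∈A , c≈b⁻¹) , x≈ac) →
         b ∙ a ⁻¹ , (b , a ⁻¹ , b∈A , (a , a∈A , refl) , refl) ,
         trans x≈ac (trans (∙-congˡ c≈b⁻¹) (sym (⁻¹-anti-homo-// b a))) }) ,
    (λ { x (y , (a , c , a∈A , (b , b∈A , c≈b⁻¹) , y≈ac) , x≈y⁻¹) →
         b , a ⁻¹ , b∈A , (a , a∈A , refl) ,
         trans x≈y⁻¹ (trans (⁻¹-cong (trans y≈ac (∙-congˡ c≈b⁻¹)))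
                            (⁻¹-anti-homo-// a b)) })

-- Totally bounded subsets of a topological group.

module TotalBoundedness {ℓ o : Level} (H : TopologicalGroup ℓ o) where
  open TopologicalGroup H
  open GroupProperties group
  open Topology topology using (open-resp; open-∩; open-⋃)

  private
    Sub : Set (suc ℓ)
    Sub = Subset setoid

  -- Division form of `x` lying in the translate `W h`. The centres `h` may be any elements of the
  -- group, not only points of `A`.
  TotallyBounded : Sub → Set (suc ℓ ⊔ o)
  TotallyBounded A = ∀ W → Open topology W → ε ∈ W →
    ∃[ hs ] (∀ x → x ∈ A → Any (λ h → x ∙ h ⁻¹ ∈ W) hs)

  leftMul rightMul : Carrier → Func setoid setoid
  leftMul  g = record { to = g ∙_ ; cong = ∙-congˡ }
  rightMul g = record { to = _∙ g ; cong = ∙-congʳ }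

  -- Joint continuity puts a box inside the preimage of `W` around each `(g , y)` with `g ∙ y ∈ W`.
  -- The union of the second sides of these boxes is the set of all `x` with `g ∙ x ∈ W`. Right
  -- multiplication uses the first sides.
  leftMul-continuous : ∀ g → Continuous topology topology (leftMul g)
  leftMul-continuous g W oW = open-resp
    ((λ { x ((y , gy∈W) , x∈) →
          let (A , B , oA , oB , g∈A , y∈B , AB⊆W) = mul-continuous W oW g y gy∈W
          in AB⊆W g x g∈A x∈ }) ,
     (λ x gx∈W → (x , gx∈W) ,
          (let (A , B , oA , oB , g∈A , x∈B , AB⊆W) = mul-continuous W oW g x gx∈W
           in x∈B)))
    (open-⋃ {I = ∃[ y ] g ∙ y ∈ W}
      (λ { (y , gy∈W) → proj₁ (proj₂ (mul-continuous W oW g y gy∈W)) })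
      (λ { (y , gy∈W) → proj₁ (proj₂ (proj₂ (proj₂ (mul-continuous W oW g y gy∈W)))) }))

  rightMul-continuous : ∀ g → Continuous topology topology (rightMul g)
  rightMul-continuous g W oW = open-resp
    ((λ { x ((y , yg∈W) , x∈) →
          let (A , B , oA , oB , y∈A , g∈B , AB⊆W) = mul-continuous W oW y g yg∈W
          in AB⊆W x g x∈ g∈B }) ,
     (λ x xg∈W → (x , xg∈W) ,
          (let (A , B , oA , oB , x∈A , g∈B , AB⊆W) = mul-continuous W oW x g xg∈W
           in x∈A)))
    (open-⋃ {I = ∃[ y ] y ∙ g ∈ W}
      (λ { (y , yg∈W) → proj₁ (mul-continuous W oW y g yg∈W) })
      (λ { (y , yg∈W) → proj₁ (proj₂ (proj₂ (mul-continuous W oW y g yg∈W))) }))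

  -- The open cover consists of all translates `W h`; each `x` lies in `W x`.
  compact⇒totallyBounded : ∀ A → IsCompact topology A → TotallyBounded A
  compact⇒totallyBounded A compact W oW ε∈W = compact Carrier
    (λ h → preimage (rightMul (h ⁻¹)) W)
    (λ h → rightMul-continuous (h ⁻¹) W oW)
    (λ x _ → x , respects W (sym (inverseʳ x)) ε∈W)

  -- Inversion turns right translates into left ones, so `TotallyBounded` does not transfer
  -- directly; the inverse of `U` is therefore handled at the level of compactness.
  setInverse-compact : ∀ A → IsCompact topology A →
    IsCompact topology (setInverse group A)
  setInverse-compact A compact I W oW cover =
    let (is , cover′) = compact I (λ i → preimage invFunc (W i))
                          (λ i → inv-continuous (W i) (oW i))
                          (λ a a∈A → cover (a ⁻¹) (a , a∈A , refl))
    in is , λ { x (a , a∈A , x≈a⁻¹) →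
         Any.map (λ {i} → respects (W i) (sym x≈a⁻¹)) (cover′ a a∈A) }

  -- If A ⊆ ⋃ W₁ gᵢ and, for each i, B ⊆ ⋃ (gᵢ⁻¹ W₂ gᵢ) hᵢⱼ, then
  -- A B ⊆ ⋃ W₁ W₂ gᵢ hᵢⱼ.
  setProduct-totallyBounded : ∀ A B → TotallyBounded A → TotallyBounded B →
    TotallyBounded (setProduct group A B)
  setProduct-totallyBounded A B tbA tbB W oW ε∈W
    with mul-continuous W oW ε ε (respects W (sym (identityˡ ε)) ε∈W)
  ... | W₁ , W₂ , oW₁ , oW₂ , ε∈W₁ , ε∈W₂ , W₁W₂⊆W =
    let (gs , coverA) = tbA W₁ oW₁ ε∈W₁
        (ks , refined) = refineCover translates gs
    in ks , λ { x (a , b , a∈A , b∈B , x≈ab) →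
         refined x (Any.map (λ a/g∈W₁ → a , b , a/g∈W₁ , b∈B , x≈ab) (coverA a a∈A)) }
    where
    conjugate : Carrier → Sub
    conjugate g = preimage (leftMul g) (preimage (rightMul (g ⁻¹)) W₂)

    regroup : ∀ a b g h → (a ∙ g ⁻¹) ∙ ((g ∙ (b ∙ h ⁻¹)) ∙ g ⁻¹) ≈ (a ∙ b) ∙ (g ∙ h) ⁻¹
    regroup a b g h = begin
      (a ∙ g ⁻¹) ∙ ((g ∙ (b ∙ h ⁻¹)) ∙ g ⁻¹)  ≈⟨ ∙-congˡ (assoc g _ _) ⟩
      (a ∙ g ⁻¹) ∙ (g ∙ ((b ∙ h ⁻¹) ∙ g ⁻¹))  ≈⟨ assoc (a ∙ g ⁻¹) g _ ⟨
      ((a ∙ g ⁻¹) ∙ g) ∙ ((b ∙ h ⁻¹) ∙ g ⁻¹)  ≈⟨ ∙-congʳ (//-rightDividesˡ g a) ⟩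
      a ∙ ((b ∙ h ⁻¹) ∙ g ⁻¹)                  ≈⟨ ∙-congˡ (assoc b _ _) ⟩
      a ∙ (b ∙ (h ⁻¹ ∙ g ⁻¹))                  ≈⟨ assoc a b _ ⟨
      (a ∙ b) ∙ (h ⁻¹ ∙ g ⁻¹)                  ≈⟨ ∙-congˡ (⁻¹-anti-homo-∙ g h) ⟨
      (a ∙ b) ∙ (g ∙ h) ⁻¹                     ∎
      where open SetoidReasoning setoid

    translates : ∀ g → ∃[ ks ] (∀ x →
      ∃[ a ] ∃[ b ] a ∙ g ⁻¹ ∈ W₁ × b ∈ B × x ≈ a ∙ b →
      Any (λ k → x ∙ k ⁻¹ ∈ W) ks)
    translates g =
      let (hs , coverB) = tbB (conjugate g)
            (leftMul-continuous g _ (rightMul-continuous (g ⁻¹) W₂ oW₂))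
            (respects W₂ (sym (trans (∙-congʳ (identityʳ g)) (inverseʳ g))) ε∈W₂)
          (ks , refined) = refineCover
            {P = λ h x → ∃[ a ] ∃[ b ] a ∙ g ⁻¹ ∈ W₁ × b ∙ h ⁻¹ ∈ conjugate g × x ≈ a ∙ b}
            (λ h → [ g ∙ h ] , λ { x (a , b , a/g∈W₁ , b/h∈ , x≈ab) → here
              (respects W (trans (regroup a b g h) (∙-congʳ (sym x≈ab)))
                (W₁W₂⊆W _ _ a/g∈W₁ b/h∈)) })
            hs
      in ks , λ { x (a , b , a/g∈W₁ , b∈B , x≈ab) →
           refined x (Any.map (λ b/h∈ → a , b , a/g∈W₁ , b/h∈ , x≈ab) (coverB b b∈B)) }

  divisionNeighbourhood : ∀ V → IsNeighbourhood topology ε V →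
    ∃[ W ] Open topology W × ε ∈ W × (∀ x y → x ∈ W → y ∈ W → x ∙ y ⁻¹ ∈ V)
  divisionNeighbourhood V (O , oO , ε∈O , O⊆V) =
    let (A , B , oA , oB , ε∈A , ε∈B , AB⊆O) =
          mul-continuous O oO ε ε (respects O (sym (identityˡ ε)) ε∈O)
    -- Intersecting `A` with the inverse of `B` gives one set usable both as numerator and as
    -- denominator.
    in A ∩ preimage invFunc B , open-∩ oA (inv-continuous B oB) ,
       (ε∈A , respects B (sym ε⁻¹≈ε) ε∈B) ,
       λ { x y (x∈A , _) (_ , y⁻¹∈B) → O⊆V _ (AB⊆O x (y ⁻¹) x∈A y⁻¹∈B) }

-- Coverings pulled back along the quasi-homomorphism.

module QuasiHomomorphism
  {ℓ o : Level} (em : ExcludedMiddle ℓ) (H : TopologicalGroup ℓ o)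
  (K : Subset (TopologicalGroup.setoid H))
  (K-symmetric : IsSymmetric (TopologicalGroup.group H) K)
  (K-compact : IsCompact (TopologicalGroup.topology H) K)
  (Λ : Group ℓ ℓ)
  (f : Func (Group.setoid Λ) (TopologicalGroup.setoid H))
  (f-quasi : IsQuasiHomomorphism Λ (TopologicalGroup.group H) K f)
  (f-quotient : ∀ x y → Func.to f (Group._∙_ Λ x (Group._⁻¹ Λ y)) ∈
    leftTranslate (TopologicalGroup.group H)
      (TopologicalGroup._∙_ H (Func.to f x) (TopologicalGroup._⁻¹ H (Func.to f y))) K)
  where

  private
    module H = TopologicalGroup H
    module Λ = Group Λ
  open Func f
  open TotalBoundedness H
  open GroupSubsets Λ
  private
    module HP = GroupProperties H.group
    module ΛP = GroupProperties Λ

    infixl 7 _·_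
    _·_ : Subset H.setoid → Subset H.setoid → Subset H.setoid
    _·_ = setProduct H.group

  X : Subset H.setoid → Subset Λ.setoid
  X U = preimage f (U · K)

  K-totallyBounded : TotallyBounded K
  K-totallyBounded = compact⇒totallyBounded K K-compact

  UK-totallyBounded : ∀ U → IsCompact H.topology U → TotallyBounded (U · K)
  UK-totallyBounded U U-compact =
    setProduct-totallyBounded U K (compact⇒totallyBounded U U-compact) K-totallyBounded

  ε∈X : ∀ U → IsNeighbourhood H.topology H.ε U → Λ.ε ∈ X U
  ε∈X U (O , _ , ε∈O , O⊆U) =
    H.ε , H.ε , O⊆U H.ε ε∈O , proj₁ K-symmetric ,
    H.trans (proj₁ f-quasi) (H.sym (H.identityˡ H.ε))

  -- The passage from `H` to `Λ`. If f(x) and f(g) lie in the same `W h`, the centre `h` cancels in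
  -- the quotient f(x) f(g)⁻¹, which lands in `V` whatever `h` was; `f-quotient` then supplies the
  -- factor from `K`.
  preimage-covered : ∀ C V → TotallyBounded C → IsNeighbourhood H.topology H.ε V →
    CoveredByRightTranslates Λ (preimage f C) (X V)
  preimage-covered C V tbC V-nbhd =
    let (W , oW , ε∈W , WW⁻¹⊆V) = divisionNeighbourhood V V-nbhd
        (hs , coverC) = tbC W oW ε∈W
        (gs , cover) = refineCover {P = λ h x → to x H.∙ h H.⁻¹ ∈ W}
                         (fibre W WW⁻¹⊆V) hs
    in gs , λ x fx∈C → cover x (coverC (to x) fx∈C)
    where
    fibre : ∀ W → (∀ x y → x ∈ W → y ∈ W → x H.∙ y H.⁻¹ ∈ V) →
      ∀ h → ∃[ gs ] (∀ x → to x H.∙ h H.⁻¹ ∈ W →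
                      Any (λ g → x ∈ rightTranslate Λ (X V) g) gs)
    -- The centre `h` need not be near the image of `f`, so excluded middle decides whether some `g`
    -- maps into `W h`. If none does, no translate is required.
    fibre W WW⁻¹⊆V h with em {∃[ g ] to g H.∙ h H.⁻¹ ∈ W}
    ... | no empty = [] , λ x x∈ → contradiction (x , x∈) empty
    ... | yes (g , g∈) = [ g ] , λ x x∈ → here (quotient∈⇒∈rightTranslate (X V)
      (let (k , k∈K , e) = f-quotient x g
       in to x H.∙ to g H.⁻¹ , k ,
          respects V (cancel x) (WW⁻¹⊆V _ _ x∈ g∈) , k∈K , e))
      where
      open SetoidReasoning H.setoid
      cancel : ∀ x → (to x H.∙ h H.⁻¹) H.∙ (to g H.∙ h H.⁻¹) H.⁻¹ H.≈ to x H.∙ to g H.⁻¹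
      cancel x = begin
        (to x H.∙ h H.⁻¹) H.∙ (to g H.∙ h H.⁻¹) H.⁻¹  ≈⟨ H.∙-congˡ (HP.⁻¹-anti-homo-// (to g) h) ⟩
        (to x H.∙ h H.⁻¹) H.∙ (h H.∙ to g H.⁻¹)       ≈⟨ H.assoc _ h _ ⟨
        ((to x H.∙ h H.⁻¹) H.∙ h) H.∙ to g H.⁻¹       ≈⟨ H.∙-congʳ (HP.//-rightDividesˡ h (to x)) ⟩
        to x H.∙ to g H.⁻¹                            ∎

  commensurable : ∀ U V →
    IsCompactIdentityNeighbourhood H U → IsCompactIdentityNeighbourhood H V →
    Commensurable Λ (X U) (X V)
  commensurable U V (U-compact , U-nbhd) (V-compact , V-nbhd) =
    preimage-covered (U · K) V (UK-totallyBounded U U-compact) V-nbhd ,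
    preimage-covered (V · K) U (UK-totallyBounded V V-compact) U-nbhd

  -- The quasi-homomorphism condition is applied at `y ⁻¹`, where its right side contains
  -- f((y⁻¹)⁻¹), that is f(y). Using `f-quotient` here would leave f(y⁻¹)⁻¹ instead.
  to-∙∈ : ∀ x y → to (x Λ.∙ y) ∈ leftTranslate H.group (to x H.∙ to y) K
  to-∙∈ x y =
    let (k , k∈K , e) = proj₂ f-quasi x (y Λ.⁻¹)
        y⁻¹⁻¹≈y = ΛP.⁻¹-involutive y
    in k , k∈K , H.trans (cong (Λ.∙-congˡ (Λ.sym y⁻¹⁻¹≈y)))
                   (H.trans e (H.∙-congʳ (H.∙-congˡ (cong y⁻¹⁻¹≈y))))

  -- One covering is the inclusion of `S` in its square, as `S` contains the identity. For the
  -- other, f(S²) lies in the totally bounded set `C · C · K`, so S² is covered by translates of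
  -- `X U`, hence of `S`. An arbitrary totally bounded `C` serves both sandwiched sets, with C = V
  -- K, and XX⁻¹.
  symmetric⇒approximateSubgroup : ∀ U C S →
    IsNeighbourhood H.topology H.ε U → TotallyBounded C →
    IsSymmetric Λ S → X U ⊆ S → S ⊆ preimage f C → IsApproximateSubgroup Λ S
  symmetric⇒approximateSubgroup U C S U-nbhd tbC S-symmetric XU⊆S S⊆f⁻¹C =
    S-symmetric ,
    ⊆⇒coveredByRightTranslates {A = S} {B = setProduct Λ S S}
      (ε∈B⇒A⊆AB S S (proj₁ S-symmetric)) ,
    coveredByRightTranslates-mono
      {A = setProduct Λ S S} {B = preimage f (C · C · K)} {C = X U} {D = S}
      SS⊆f⁻¹CCK XU⊆S
      (preimage-covered (C · C · K) U
        (setProduct-totallyBounded (C · C) K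
          (setProduct-totallyBounded C C tbC tbC) K-totallyBounded)
        U-nbhd)
    where
    SS⊆f⁻¹CCK : setProduct Λ S S ⊆ preimage f (C · C · K)
    SS⊆f⁻¹CCK x (s , t , s∈S , t∈S , x≈st) =
      let (k , k∈K , e) = to-∙∈ s t
      in to s H.∙ to t , k ,
         (to s , to t , S⊆f⁻¹C s s∈S , S⊆f⁻¹C t t∈S , H.refl) , k∈K ,
         H.trans (cong x≈st) e

  XX⁻¹-approximateSubgroup : ∀ U → IsCompactIdentityNeighbourhood H U →
    IsApproximateSubgroup Λ (setProduct Λ (X U) (setInverse Λ (X U)))
  XX⁻¹-approximateSubgroup U (U-compact , U-nbhd) =
    symmetric⇒approximateSubgroup U C (setProduct Λ (X U) (setInverse Λ (X U))) U-nbhd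
      (setProduct-totallyBounded (U · K · (K · U⁻¹)) K
        (setProduct-totallyBounded (U · K) (K · U⁻¹)
          (UK-totallyBounded U U-compact)
          (setProduct-totallyBounded K U⁻¹ K-totallyBounded
            (compact⇒totallyBounded U⁻¹ (setInverse-compact U U-compact))))
        K-totallyBounded)
      (AA⁻¹-symmetric (X U) (ε∈X U U-nbhd))
      (ε∈B⇒A⊆AB (X U) (setInverse Λ (X U)) (ε∈setInverse (X U) (ε∈X U U-nbhd)))
      XX⁻¹⊆f⁻¹C
    where
    U⁻¹ C : Subset H.setoid
    U⁻¹ = setInverse H.group U
    -- For x and y in `X U`, f(x y⁻¹) lies in f(x) f(y)⁻¹ K. Writing f(y) = u k gives f(y)⁻¹ = k⁻¹
    -- u⁻¹, which is in `K · U⁻¹` because `K` is symmetric.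
    C = U · K · (K · U⁻¹) · K

    XX⁻¹⊆f⁻¹C : setProduct Λ (X U) (setInverse Λ (X U)) ⊆ preimage f C
    XX⁻¹⊆f⁻¹C z (x , y′ , x∈X , (y , (u , k , u∈U , k∈K , fy≈uk) , y′≈y⁻¹) , z≈xy′) =
      let (l , l∈K , e) = f-quotient x y
      in to x H.∙ to y H.⁻¹ , l ,
         (to x , to y H.⁻¹ , x∈X ,
          (k H.⁻¹ , u H.⁻¹ , GroupSubsets.symmetric-⁻¹ H.group K K-symmetric k∈K ,
           (u , u∈U , H.refl) ,
           H.trans (H.⁻¹-cong fy≈uk) (HP.⁻¹-anti-homo-∙ u k)) ,
          H.refl) ,
         l∈K ,
         H.trans (cong (Λ.trans z≈xy′ (Λ.∙-congˡ y′≈y⁻¹))) e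

proposition5p12 : ∀ {ℓ o : Level} → ExcludedMiddle ℓ →
  (H : TopologicalGroup ℓ o) (let module H = TopologicalGroup H) →
  IsLocallyCompact H.topology →
  (K : Subset H.setoid) → IsSymmetric H.group K → IsCompact H.topology K →
  (Λ : Group ℓ ℓ) (let module Λ = Group Λ) →
  (f : Func Λ.setoid H.setoid) (let open Func f) →
  IsQuasiHomomorphism Λ H.group K f →
  (∀ x y → to (x Λ.∙ y Λ.⁻¹) ∈ leftTranslate H.group (to x H.∙ to y H.⁻¹) K) →
  let X : Subset H.setoid → Subset Λ.setoid
      X U = preimage f (setProduct H.group U K)
      CompactNbhd = IsCompactIdentityNeighbourhood H
  in
    (∀ U V → CompactNbhd U → CompactNbhd V → Commensurable Λ (X U) (X V))
  × (∀ U V → CompactNbhd U → CompactNbhd V →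
     ∀ S → IsSymmetric Λ S → X U ⊆ S → S ⊆ X V → IsApproximateSubgroup Λ S)
  × (∀ U → CompactNbhd U →
     IsApproximateSubgroup Λ (setProduct Λ (X U) (setInverse Λ (X U))))
proposition5p12 em H _ K K-symmetric K-compact Λ f f-quasi f-quotient =
  commensurable ,
  (λ { U V (_ , U-nbhd) (V-compact , _) S S-symmetric XU⊆S S⊆XV →
       symmetric⇒approximateSubgroup U (setProduct (TopologicalGroup.group H) V K) S U-nbhd
         (UK-totallyBounded V V-compact) S-symmetric XU⊆S S⊆XV }) ,
  XX⁻¹-approximateSubgroup
  where
  open QuasiHomomorphism em H K K-symmetric K-compact Λ f f-quasi f-quotient
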